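{- Let $n\ge 1$ and $0\le p\le n$ be integers. Then, as an identity of formal power series in $y$, $$\sum_{k\ge 1}\binom{n}{p}_k\,y^k=n\,y\,(y+1)^p\;{}_2F_1\!\left[\begin{matrix}p+1,\;p-n+1\\ 2\end{matrix};-y\right].$$
   Context: For $a$ a number and $r\ge 0$ an integer, $(a)_r=a(a+1)\cdots(a+r-1)$ denotes the raising factorial, with $(a)_0=1$. The Gauss hypergeometric series is ${}_2F_1\!\left[\begin{matrix}a,b\\ c\end{matrix};z\right]=\sum_{j\ge 0}\frac{(a)_j(b)_j}{(c)_j}\frac{z^j}{j!}$. For integers $n\ge 1$, $0\le p\le n$, $k\ge 0$, define $$\binom{n}{p}_k=\binom{n}{k}\;{}_3F_2\!\left[\begin{matrix}1-k,\,-p,\,p-n\\ 1-n,\,1\end{matrix};1\right]=\binom{n}{k}\sum_{r=0}^{\min(p,n-p)}\frac{(1-k)_r\,(-p)_r\,(p-n)_r}{(1-n)_r\,(1)_r\,r!}.$$ The sum is finite because $(-p)_r(p-n)_r=0$ for $r>\min(p,n-p)$, and the denominators are nonzero in the stated range. Here $\binom{n}{k}$ is the usual binomial coefficient, equal to $0$ for $k>n$; hence $\binom{n}{p}_k=0$ for $k>n$. -}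

module Defs where

open import Algebra.Definitions.RawSemiring using (sum; _^_)
open import Data.Fin.Base using (toℕ)
import Data.Integer.Base as ℤ
open import Data.Nat.Base as ℕ using (ℕ; zero; suc; _∸_; _⊓_; _!)
open import Data.Nat.Combinatorics using (_C_)
open import Data.Rational.Base
  using (ℚ; 0ℚ; 1ℚ; _/_; _+_; _-_; _*_; -_; 1/_; ≢-nonZero; +-*-rawSemiring)
open import Data.Rational.Properties using (_≟_)
open import Function.Base using (_∘_)
open import Relation.Binary.PropositionalEquality using (_≡_)
open import Relation.Nullary.Decidable.Core using (yes; no)

fromℕ : ℕ → ℚ
fromℕ n = ℤ.+ n / 1

-- Total reciprocal, with the convention 1/0 = 0.  The convention is never
-- used below when n ≥ 1 and p ≤ n: in `binom n p k`, r ≤ min(p, n ∸ p) gives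
-- r ≤ n - 1, so (1 - n)_r ≠ 0; and (2)_j ≠ 0 for every j.
recip : ℚ → ℚ
recip q with q ≟ 0ℚ
... | yes _   = 0ℚ
... | no  q≢0 = 1/_ q {{≢-nonZero q≢0}}

infixl 7 _÷₀_
_÷₀_ : ℚ → ℚ → ℚ
q ÷₀ r = q * recip r

∑< : ℕ → (ℕ → ℚ) → ℚ
∑< m f = sum +-*-rawSemiring {m} (f ∘ toℕ)

rising : ℚ → ℕ → ℚ
rising a zero    = 1ℚ
rising a (suc r) = rising a r * (a + fromℕ r)

-- A formal power series is its coefficient sequence.
PowerSeries : Set
PowerSeries = ℕ → ℚ

infix 4 _≈ₛ_
_≈ₛ_ : PowerSeries → PowerSeries → Set
f ≈ₛ g = ∀ k → f k ≡ g k

const : ℚ → PowerSeries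
const c zero    = c
const c (suc _) = 0ℚ

Y : PowerSeries
Y 1 = 1ℚ
Y _ = 0ℚ

infixl 6 _+ₛ_
_+ₛ_ : PowerSeries → PowerSeries → PowerSeries
(f +ₛ g) k = f k + g k

infixl 7 _*ₛ_
_*ₛ_ : PowerSeries → PowerSeries → PowerSeries
(f *ₛ g) k = ∑< (suc k) (λ i → f i * g (k ∸ i))

infixr 8 _^ₛ_
_^ₛ_ : PowerSeries → ℕ → PowerSeries
f ^ₛ zero  = const 1ℚ
f ^ₛ suc m = f *ₛ f ^ₛ m

-- The substitution f(y) ↦ f(c y).
_[_·y] : PowerSeries → ℚ → PowerSeries
(f [ c ·y]) j = f j * _^_ +-*-rawSemiring c j

-- The series ∑_{k ≥ 1} a(k) y^k.
∑≥1 : (ℕ → ℚ) → PowerSeries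
∑≥1 a zero    = 0ℚ
∑≥1 a (suc k) = a (suc k)

₂F₁ : (a b c : ℚ) → PowerSeries
₂F₁ a b c j = (rising a j * rising b j) ÷₀ (rising c j * fromℕ (j !))

-- The coefficient of z^r in ₃F₂[a, b, c; d, e; z].
₃F₂-coeff : (a b c d e : ℚ) → ℕ → ℚ
₃F₂-coeff a b c d e r =
  (rising a r * rising b r * rising c r)
    ÷₀ (rising d r * rising e r * fromℕ (r !))

binom : (n p k : ℕ) → ℚ
binom n p k =
  fromℕ (n C k) *
  ∑< (suc (p ⊓ (n ∸ p)))
     (₃F₂-coeff (1ℚ - fromℕ k) (- fromℕ p) (fromℕ p - fromℕ n)
                (1ℚ - fromℕ n) 1ℚ)

{-# OPTIONS --safe #-}
-- Put n = p + q, H = ∑ⱼ C(p+j,j) C(q,j) yʲ and g = ₂F₁[p+1, p-n+1; 2; -y].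
-- Absorbing C(n,k) into the terms of the ₃F₂ gives
-- k [yᵏ] LHS = n [yᵏ⁻¹] D with D = ∑ᵣ C(p,r) C(q,r) yʳ (1+y)ⁿ⁻¹⁻ʳ, and Vandermonde's
-- identity gives D = (1+y)ᵖ⁻¹ H (a Pfaff transformation).  On the other side
-- (y (1+y)ᵖ g)′ = (1+y)ᵖ⁻¹ ((1+y) (y g)′ + p y g), and (1+y) (y g)′ + p y g = H by
-- comparing hypergeometric terms.  When p = 0, where (1+y)ᵖ⁻¹ is not a polynomial,
-- both sides are (1+y)ⁿ⁻¹ directly.
module Submission where

open import Defs
open import Data.Nat.Base using (ℕ; _≤_)
open import Data.Rational.Base using (1ℚ; _+_; _-_; -_)

open import Algebra.Bundles using (CommutativeRing)
open import Data.Fin.Base using (toℕ)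
open import Data.Fin.Properties using (toℕ<n)
import Data.Integer.Base as ℤ
import Data.Integer.Properties as ℤ
open import Data.Nat.Base as ℕ using (zero; suc; _<_; _∸_; _⊓_; _!; z≤n; s≤s)
open import Data.Nat.Combinatorics
  using (_C_; nCk+nC[k+1]≡[n+1]C[k+1]; nCk≡nC[n∸k]; nCn≡1; k>n⇒nCk≡0)
import Data.Nat.Properties as ℕ
open import Data.Rational.Base using (ℚ; 0ℚ; _*_; toℚᵘ; ≢-nonZero; +-*-rawSemiring)
open import Data.Rational.Properties
  using (_≟_; +-*-commutativeRing; toℚᵘ-injective; toℚᵘ-fromℚᵘ; toℚᵘ-homo-+; toℚᵘ-homo-*;
         *-inverseˡ; *-assoc; *-comm; *-identityˡ; *-zeroˡ; *-zeroʳ;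
         +-identityˡ; +-identityʳ)
open import Data.Rational.Solver using (module +-*-Solver)
open import Data.Rational.Unnormalised.Base as ℚᵘ using (mkℚᵘ; *≡*)
import Data.Rational.Unnormalised.Properties as ℚᵘ
open import Data.Sum.Base using (inj₁; inj₂)
open import Function.Base using (_∘_)
open import Algebra.Definitions.RawSemiring using (_^_)
open import Relation.Binary.PropositionalEquality
  using (_≡_; _≢_; refl; sym; trans; cong; cong₂; subst; module ≡-Reasoning)
open import Relation.Nullary.Decidable.Core using (Dec; yes; no)
open import Relation.Nullary.Negation using (contradiction)

open import Algebra.Properties.Semiring.Sum
  (CommutativeRing.semiring +-*-commutativeRing) using (sum-cong-≗; *-distribˡ-sum)
open +-*-Solver using (solve; con; _:+_; _:*_; _:-_; :-_; _:=_)
open ≡-Reasoning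

-- The factor k has two roles. On the left, absorption by k moves C(n,k) to row N = n - 1; since the
-- lower parameter 1 - n is -N, the denominator of the r-th ₃F₂ term becomes C(N,r), which can then
-- be cancelled. On the right, k is differentiation, which loses only the constant term, and that is
-- 0 on both sides. Passing to the derivative is also what makes the right side tractable: g need
-- not terminate (for q = 0 its second upper parameter is 1), whereas H is always a polynomial.
-- After `÷₀-step` quotients disappear. A hypergeometric term enters only through the ratio of
-- consecutive terms, cleared of denominators, and an identity between terms is an induction on that
-- ratio followed by cancellation of a nonzero rational.

-- Naturals in the rationals, and total division

toℚᵘ-fromℕ : ∀ n → toℚᵘ (fromℕ n) ℚᵘ.≃ mkℚᵘ (ℤ.+ n) 0
toℚᵘ-fromℕ n = toℚᵘ-fromℚᵘ (mkℚᵘ (ℤ.+ n) 0)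

-- `_/_` normalises by a gcd, which is stuck on a variable numerator; in `ℚᵘ` numerator and
-- denominator are explicit.
fromℕ-+ : ∀ m n → fromℕ (m ℕ.+ n) ≡ fromℕ m + fromℕ n
fromℕ-+ m n = toℚᵘ-injective
  (ℚᵘ.≃-trans (toℚᵘ-fromℕ (m ℕ.+ n))
  (ℚᵘ.≃-trans (*≡* (cong (ℤ._* ℤ.+ 1)
                 (sym (cong₂ ℤ._+_ (ℤ.*-identityʳ (ℤ.+ m)) (ℤ.*-identityʳ (ℤ.+ n))))))
  (ℚᵘ.≃-trans (ℚᵘ.+-cong (ℚᵘ.≃-sym (toℚᵘ-fromℕ m)) (ℚᵘ.≃-sym (toℚᵘ-fromℕ n)))
              (ℚᵘ.≃-sym (toℚᵘ-homo-+ (fromℕ m) (fromℕ n))))))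

fromℕ-* : ∀ m n → fromℕ (m ℕ.* n) ≡ fromℕ m * fromℕ n
fromℕ-* m n = toℚᵘ-injective
  (ℚᵘ.≃-trans (toℚᵘ-fromℕ (m ℕ.* n))
  (ℚᵘ.≃-trans (*≡* (cong (ℤ._* ℤ.+ 1) (ℤ.pos-* m n)))
  (ℚᵘ.≃-trans (ℚᵘ.*-cong (ℚᵘ.≃-sym (toℚᵘ-fromℕ m)) (ℚᵘ.≃-sym (toℚᵘ-fromℕ n)))
              (ℚᵘ.≃-sym (toℚᵘ-homo-* (fromℕ m) (fromℕ n))))))

fromℕ-suc : ∀ n → fromℕ (suc n) ≡ 1ℚ + fromℕ n
fromℕ-suc = fromℕ-+ 1

fromℕ-suc≢0 : ∀ n → fromℕ (suc n) ≢ 0ℚ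
fromℕ-suc≢0 n eq
  with ℚᵘ.≃-trans (ℚᵘ.≃-sym (toℚᵘ-fromℕ (suc n))) (ℚᵘ.≃-reflexive (cong toℚᵘ eq))
... | *≡* ()

1+fromℕ≢0 : ∀ n → 1ℚ + fromℕ n ≢ 0ℚ
1+fromℕ≢0 n eq = fromℕ-suc≢0 n (trans (fromℕ-suc n) eq)

fromℕ-∸≢0 : ∀ {r n} → r < n → fromℕ n - fromℕ r ≢ 0ℚ
fromℕ-∸≢0 {r} {n} r<n eq = fromℕ-suc≢0 (n ∸ suc r) (begin
  fromℕ (suc (n ∸ suc r))                        ≡⟨ solve 2 (λ x y → x := (y :+ x) :- y) refl _ (fromℕ r) ⟩
  (fromℕ r + fromℕ (suc (n ∸ suc r))) - fromℕ r  ≡⟨ cong (_- fromℕ r) (fromℕ-+ r (suc (n ∸ suc r))) ⟨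
  fromℕ (r ℕ.+ suc (n ∸ suc r)) - fromℕ r        ≡⟨ cong (λ x → fromℕ x - fromℕ r)
                                                      (trans (ℕ.+-suc r _) (ℕ.m+[n∸m]≡n r<n)) ⟩
  fromℕ n - fromℕ r                              ≡⟨ eq ⟩
  0ℚ                                             ∎)

recip-inverseˡ : ∀ {x} → x ≢ 0ℚ → recip x * x ≡ 1ℚ
recip-inverseˡ {x} x≢0 with x ≟ 0ℚ
... | yes x≡0 = contradiction x≡0 x≢0
... | no  x≢0 = *-inverseˡ x {{≢-nonZero x≢0}}

*-cancelˡ : ∀ {x y z} → x ≢ 0ℚ → x * y ≡ x * z → y ≡ z
*-cancelˡ {x} {y} {z} x≢0 eq = begin
  y                  ≡⟨ divide y ⟨
  recip x * (x * y)  ≡⟨ cong (recip x *_) eq ⟩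
  recip x * (x * z)  ≡⟨ divide z ⟩
  z                  ∎
  where
  divide : ∀ w → recip x * (x * w) ≡ w
  divide w = trans (sym (*-assoc (recip x) x w))
                   (trans (cong (_* w) (recip-inverseˡ x≢0)) (*-identityˡ w))

*-≢0 : ∀ {x y} → x ≢ 0ℚ → y ≢ 0ℚ → x * y ≢ 0ℚ
*-≢0 {x} x≢0 y≢0 eq = y≢0 (*-cancelˡ x≢0 (trans eq (sym (*-zeroʳ x))))

-- At x = 0 both sides are 0 by the convention 1/0 = 0. Hence a term ratio has to know only that the
-- newly added factor of the denominator is nonzero, and nothing about the product accumulated
-- before it.
recip-*-cancelʳ : ∀ x {y} → y ≢ 0ℚ → recip (x * y) * y ≡ recip x
recip-*-cancelʳ x {y} y≢0 = go (x ≟ 0ℚ)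
  where
  go : Dec (x ≡ 0ℚ) → recip (x * y) * y ≡ recip x
  go (yes x≡0) = subst (λ z → recip (z * y) * y ≡ recip z) (sym x≡0)
    (trans (cong (λ z → recip z * y) (*-zeroˡ y)) (*-zeroˡ y))
  go (no x≢0) = *-cancelˡ x≢0 (begin
    x * (recip (x * y) * y)  ≡⟨ solve 3 (λ a b c → a :* (c :* b) := c :* (a :* b)) refl x y (recip (x * y)) ⟩
    recip (x * y) * (x * y)  ≡⟨ recip-inverseˡ (*-≢0 x≢0 y≢0) ⟩
    1ℚ                       ≡⟨ recip-inverseˡ x≢0 ⟨
    recip x * x              ≡⟨ *-comm (recip x) x ⟩
    x * recip x              ∎)

÷₀-step : ∀ x y a {b} → b ≢ 0ℚ → ((x * a) ÷₀ (y * b)) * b ≡ (x ÷₀ y) * a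
÷₀-step x y a {b} b≢0 = begin
  ((x * a) * recip (y * b)) * b  ≡⟨ solve 4 (λ x a r b → ((x :* a) :* r) :* b := (x :* (r :* b)) :* a) refl x a _ b ⟩
  (x * (recip (y * b) * b)) * a  ≡⟨ cong (λ z → (x * z) * a) (recip-*-cancelʳ y b≢0) ⟩
  (x * recip y) * a              ∎

-- Ratios of consecutive hypergeometric terms

₂F₁-step : ∀ a b c j → c + fromℕ j ≢ 0ℚ →
  ₂F₁ a b c (suc j) * ((c + fromℕ j) * (1ℚ + fromℕ j))
    ≡ ₂F₁ a b c j * ((a + fromℕ j) * (b + fromℕ j))
₂F₁-step a b c j c+j≢0 = begin
  ₂F₁ a b c (suc j) * d  ≡⟨ cong (_* d) (cong₂ _÷₀_ num den) ⟩
  _                      ≡⟨ ÷₀-step (rising a j * rising b j) (rising c j * fromℕ (j !)) _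
                              (*-≢0 c+j≢0 (1+fromℕ≢0 j)) ⟩
  _                      ∎
  where
  d = (c + fromℕ j) * (1ℚ + fromℕ j)
  interchange : ∀ w x y z → (w * x) * (y * z) ≡ (w * y) * (x * z)
  interchange = solve 4 (λ w x y z → (w :* x) :* (y :* z) := (w :* y) :* (x :* z)) refl
  num = interchange (rising a j) (a + fromℕ j) (rising b j) (b + fromℕ j)
  den : rising c (suc j) * fromℕ (suc j !) ≡ (rising c j * fromℕ (j !)) * d
  den = begin
    rising c (suc j) * fromℕ (suc j !)                      ≡⟨ cong (rising c (suc j) *_) (fromℕ-* (suc j) (j !)) ⟩
    rising c (suc j) * (fromℕ (suc j) * fromℕ (j !))        ≡⟨ cong (λ z → rising c (suc j) * (z * fromℕ (j !))) (fromℕ-suc j) ⟩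
    rising c (suc j) * ((1ℚ + fromℕ j) * fromℕ (j !))       ≡⟨ cong (rising c (suc j) *_) (*-comm (1ℚ + fromℕ j) _) ⟩
    rising c (suc j) * (fromℕ (j !) * (1ℚ + fromℕ j))       ≡⟨ interchange (rising c j) _ _ _ ⟩
    (rising c j * fromℕ (j !)) * d                          ∎

₃F₂-step : ∀ a b c d e r → d + fromℕ r ≢ 0ℚ → e + fromℕ r ≢ 0ℚ →
  ₃F₂-coeff a b c d e (suc r) * ((d + fromℕ r) * (e + fromℕ r) * (1ℚ + fromℕ r))
    ≡ ₃F₂-coeff a b c d e r * ((a + fromℕ r) * (b + fromℕ r) * (c + fromℕ r))
₃F₂-step a b c d e r d+r≢0 e+r≢0 = begin
  ₃F₂-coeff a b c d e (suc r) * D  ≡⟨ cong (_* D) (cong₂ _÷₀_ num den) ⟩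
  _                                ≡⟨ ÷₀-step (rising a r * rising b r * rising c r)
                                        (rising d r * rising e r * fromℕ (r !)) _
                                        (*-≢0 (*-≢0 d+r≢0 e+r≢0) (1+fromℕ≢0 r)) ⟩
  _                                ∎
  where
  D = (d + fromℕ r) * (e + fromℕ r) * (1ℚ + fromℕ r)
  interchange : ∀ u v w x y z → (u * v) * (w * x) * (y * z) ≡ (u * w * y) * (v * x * z)
  interchange = solve 6 (λ u v w x y z → (u :* v) :* (w :* x) :* (y :* z) := (u :* w :* y) :* (v :* x :* z)) refl
  num = interchange (rising a r) (a + fromℕ r) (rising b r) (b + fromℕ r) (rising c r) (c + fromℕ r)
  de = rising d (suc r) * rising e (suc r)
  den : de * fromℕ (suc r !) ≡ (rising d r * rising e r * fromℕ (r !)) * D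
  den = begin
    de * fromℕ (suc r !)                 ≡⟨ cong (de *_) (fromℕ-* (suc r) (r !)) ⟩
    de * (fromℕ (suc r) * fromℕ (r !))   ≡⟨ cong (λ z → de * (z * fromℕ (r !))) (fromℕ-suc r) ⟩
    de * ((1ℚ + fromℕ r) * fromℕ (r !))  ≡⟨ cong (de *_) (*-comm (1ℚ + fromℕ r) _) ⟩
    de * (fromℕ (r !) * (1ℚ + fromℕ r))  ≡⟨ interchange (rising d r) _ _ _ _ _ ⟩
    _                                    ∎

-- Binomial coefficients

-- Read as a series, row `n` of Pascal's triangle is (1+y)ⁿ.
bin : ℕ → PowerSeries
bin n k = fromℕ (n C k)

bin-pascal : ∀ n k → bin (suc n) (suc k) ≡ bin n k + bin n (suc k)
bin-pascal n k = trans (cong fromℕ (sym (nCk+nC[k+1]≡[n+1]C[k+1] n k))) (fromℕ-+ (n C k) (n C suc k))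

k>n⇒bin≡0 : ∀ {n k} → n < k → bin n k ≡ 0ℚ
k>n⇒bin≡0 n<k = cong fromℕ (k>n⇒nCk≡0 n<k)

-- Pascal's rule carries the induction. The difference is taken in ℚ, so the ratio holds across k =
-- n: there the factor n - k vanishes, and beyond it both entries do.
bin-step : ∀ n k → (1ℚ + fromℕ k) * bin n (suc k) ≡ (fromℕ n - fromℕ k) * bin n k
bin-step zero zero = refl
bin-step zero (suc k) = trans (*-zeroʳ (1ℚ + fromℕ (suc k))) (sym (*-zeroʳ (fromℕ 0 - fromℕ (suc k))))
bin-step (suc n) zero = begin
  (1ℚ + 0ℚ) * bin (suc n) 1        ≡⟨ cong ((1ℚ + 0ℚ) *_) (bin-pascal n 0) ⟩
  (1ℚ + 0ℚ) * (1ℚ + bin n 1)       ≡⟨ solve 1 (λ b → (con 1ℚ :+ con 0ℚ) :* (con 1ℚ :+ b)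
                                         := con 1ℚ :+ (con 1ℚ :+ con 0ℚ) :* b) refl (bin n 1) ⟩
  1ℚ + (1ℚ + 0ℚ) * bin n 1         ≡⟨ cong (1ℚ +_) (bin-step n 0) ⟩
  1ℚ + (fromℕ n - 0ℚ) * 1ℚ         ≡⟨ solve 1 (λ n → con 1ℚ :+ (n :- con 0ℚ) :* con 1ℚ
                                         := ((con 1ℚ :+ n) :- con 0ℚ) :* con 1ℚ) refl (fromℕ n) ⟩
  ((1ℚ + fromℕ n) - 0ℚ) * 1ℚ       ≡⟨ cong (λ z → (z - 0ℚ) * 1ℚ) (fromℕ-suc n) ⟨
  (fromℕ (suc n) - 0ℚ) * 1ℚ        ∎
bin-step (suc n) (suc k) = begin
  (1ℚ + fromℕ (suc k)) * bin (suc n) (suc (suc k))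
    ≡⟨ cong₂ _*_ (cong (1ℚ +_) (fromℕ-suc k)) (bin-pascal n (suc k)) ⟩
  (1ℚ + (1ℚ + K)) * (y + z)
    ≡⟨ solve 3 (λ K y z → (con 1ℚ :+ (con 1ℚ :+ K)) :* (y :+ z)
         := y :+ (con 1ℚ :+ K) :* y :+ (con 1ℚ :+ (con 1ℚ :+ K)) :* z) refl K y z ⟩
  y + (1ℚ + K) * y + (1ℚ + (1ℚ + K)) * z
    ≡⟨ cong₂ (λ u v → y + u + v) (bin-step n k)
         (subst (λ w → (1ℚ + w) * z ≡ (N - w) * y) (fromℕ-suc k) (bin-step n (suc k))) ⟩
  y + (N - K) * x + (N - (1ℚ + K)) * y
    ≡⟨ solve 4 (λ N K x y → y :+ (N :- K) :* x :+ (N :- (con 1ℚ :+ K)) :* y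
         := ((con 1ℚ :+ N) :- (con 1ℚ :+ K)) :* (x :+ y)) refl N K x y ⟩
  ((1ℚ + N) - (1ℚ + K)) * (x + y)
    ≡⟨ cong₂ _*_ (cong₂ _-_ (fromℕ-suc n) (fromℕ-suc k)) (bin-pascal n k) ⟨
  (fromℕ (suc n) - fromℕ (suc k)) * bin (suc n) (suc k) ∎
  where
  N = fromℕ n
  K = fromℕ k
  x = bin n k
  y = bin n (suc k)
  z = bin n (suc (suc k))

bin-absorb : ∀ n k → (1ℚ + fromℕ k) * bin (suc n) (suc k) ≡ (1ℚ + fromℕ n) * bin n k
bin-absorb n k = begin
  (1ℚ + K) * bin (suc n) (suc k)                ≡⟨ cong ((1ℚ + K) *_) (bin-pascal n k) ⟩
  (1ℚ + K) * (bin n k + bin n (suc k))          ≡⟨ solve 3 (λ K x y → (con 1ℚ :+ K) :* (x :+ y)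
                                                     := (con 1ℚ :+ K) :* x :+ (con 1ℚ :+ K) :* y) refl K (bin n k) _ ⟩
  (1ℚ + K) * bin n k + (1ℚ + K) * bin n (suc k) ≡⟨ cong ((1ℚ + K) * bin n k +_) (bin-step n k) ⟩
  (1ℚ + K) * bin n k + (fromℕ n - K) * bin n k  ≡⟨ solve 3 (λ N K x → (con 1ℚ :+ K) :* x :+ (N :- K) :* x
                                                     := (con 1ℚ :+ N) :* x) refl (fromℕ n) K (bin n k) ⟩
  (1ℚ + fromℕ n) * bin n k                      ∎
  where K = fromℕ k

bin≢0 : ∀ {n} k → k ≤ n → bin n k ≢ 0ℚ
bin≢0     zero    _   ()
bin≢0 {n} (suc k) k<n eq = *-≢0 (fromℕ-∸≢0 k<n) (bin≢0 k (ℕ.<⇒≤ k<n)) (begin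
  (fromℕ n - fromℕ k) * bin n k   ≡⟨ bin-step n k ⟨
  (1ℚ + fromℕ k) * bin n (suc k)  ≡⟨ cong ((1ℚ + fromℕ k) *_) eq ⟩
  (1ℚ + fromℕ k) * 0ℚ             ≡⟨ *-zeroʳ (1ℚ + fromℕ k) ⟩
  0ℚ                              ∎)

-- Finite sums

∑<-cong : ∀ m {f g : ℕ → ℚ} → (∀ i → i < m → f i ≡ g i) → ∑< m f ≡ ∑< m g
∑<-cong m f≡g = sum-cong-≗ {m} (λ i → f≡g (toℕ i) (toℕ<n i))

*-distribˡ-∑< : ∀ m c (f : ℕ → ℚ) → c * ∑< m f ≡ ∑< m (λ i → c * f i)
*-distribˡ-∑< m c f = *-distribˡ-sum {m} c (f ∘ toℕ)

∑<-zero : ∀ m {f : ℕ → ℚ} → (∀ i → f i ≡ 0ℚ) → ∑< m f ≡ 0ℚ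
∑<-zero zero    _   = refl
∑<-zero (suc m) f≡0 = cong₂ _+_ (f≡0 0) (∑<-zero m (f≡0 ∘ suc))

-- Lets the Vandermonde range r ≤ j be traded for the range r ≤ min(p,q) of the ₃F₂ without deciding
-- which is longer.
∑<-truncate : ∀ m n {f : ℕ → ℚ} →
  (∀ i → m ≤ i → f i ≡ 0ℚ) → (∀ i → n ≤ i → f i ≡ 0ℚ) → ∑< m f ≡ ∑< n f
∑<-truncate zero    n       {f} f≡0 _    = sym (∑<-zero n {f} (λ i → f≡0 i z≤n))
∑<-truncate (suc m) zero    {f} _   f≡0′ = ∑<-zero (suc m) {f} (λ i → f≡0′ i z≤n)
∑<-truncate (suc m) (suc n) {f} f≡0 f≡0′ = cong (f 0 +_)
  (∑<-truncate m n (λ i m≤i → f≡0 (suc i) (s≤s m≤i)) (λ i n≤i → f≡0′ (suc i) (s≤s n≤i)))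

-- Algebra of formal power series

0ₛ : PowerSeries
0ₛ _ = 0ℚ

infixr 7 _·ₛ_
_·ₛ_ : ℚ → PowerSeries → PowerSeries
(c ·ₛ f) k = c * f k

shift : PowerSeries → PowerSeries
shift f zero    = 0ℚ
shift f (suc k) = f k

shift^ : ℕ → PowerSeries → PowerSeries
shift^ zero    f = f
shift^ (suc r) f = shift (shift^ r f)

shift-cong : ∀ {f g} → f ≈ₛ g → shift f ≈ₛ shift g
shift-cong f≈g zero    = refl
shift-cong f≈g (suc k) = f≈g k

shift^-cong : ∀ r {f g} → f ≈ₛ g → shift^ r f ≈ₛ shift^ r g
shift^-cong zero    f≈g = f≈g
shift^-cong (suc r) f≈g = shift-cong (shift^-cong r f≈g)

*ₛ-cong : ∀ {f f′ g g′} → f ≈ₛ f′ → g ≈ₛ g′ → f *ₛ g ≈ₛ f′ *ₛ g′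
*ₛ-cong f≈f′ g≈g′ k = ∑<-cong (suc k) (λ i _ → cong₂ _*_ (f≈f′ i) (g≈g′ (k ∸ i)))

-- Since `∑<` unfolds from its first term, `(f *ₛ g) (suc k)` is by computation
-- `f 0 * g (suc k) + ((f ∘ suc) *ₛ g) k`. This and the following inductive product laws peel off
-- the constant term of the left factor in this way.
*ₛ-distribʳ-+ₛ : ∀ f g h → (f +ₛ g) *ₛ h ≈ₛ f *ₛ h +ₛ g *ₛ h
*ₛ-distribʳ-+ₛ f g h zero = solve 3 (λ f g h → (f :+ g) :* h :+ con 0ℚ
  := (f :* h :+ con 0ℚ) :+ (g :* h :+ con 0ℚ)) refl (f 0) (g 0) (h 0)
*ₛ-distribʳ-+ₛ f g h (suc k) =
  trans (cong ((f 0 + g 0) * h (suc k) +_) (*ₛ-distribʳ-+ₛ (f ∘ suc) (g ∘ suc) h k))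
        (solve 5 (λ f g h x y → (f :+ g) :* h :+ (x :+ y) := (f :* h :+ x) :+ (g :* h :+ y)) refl
           (f 0) (g 0) (h (suc k)) _ _)

*ₛ-distribˡ-+ₛ : ∀ f g h → f *ₛ (g +ₛ h) ≈ₛ f *ₛ g +ₛ f *ₛ h
*ₛ-distribˡ-+ₛ f g h zero = solve 3 (λ f g h → f :* (g :+ h) :+ con 0ℚ
  := (f :* g :+ con 0ℚ) :+ (f :* h :+ con 0ℚ)) refl (f 0) (g 0) (h 0)
*ₛ-distribˡ-+ₛ f g h (suc k) =
  trans (cong (f 0 * (g (suc k) + h (suc k)) +_) (*ₛ-distribˡ-+ₛ (f ∘ suc) g h k))
        (solve 5 (λ f g h x y → f :* (g :+ h) :+ (x :+ y) := (f :* g :+ x) :+ (f :* h :+ y)) refl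
           (f 0) (g (suc k)) (h (suc k)) _ _)

·ₛ-*ₛ-assoc : ∀ c f g → (c ·ₛ f) *ₛ g ≈ₛ c ·ₛ (f *ₛ g)
·ₛ-*ₛ-assoc c f g k =
  trans (∑<-cong (suc k) (λ i _ → *-assoc c (f i) (g (k ∸ i)))) (sym (*-distribˡ-∑< (suc k) c (λ i → f i * g (k ∸ i))))

*ₛ-·ₛ-comm : ∀ c f g → f *ₛ (c ·ₛ g) ≈ₛ c ·ₛ (f *ₛ g)
*ₛ-·ₛ-comm c f g k =
  trans (∑<-cong (suc k) (λ i _ → solve 3 (λ c x y → x :* (c :* y) := c :* (x :* y)) refl c (f i) (g (k ∸ i))))
        (sym (*-distribˡ-∑< (suc k) c (λ i → f i * g (k ∸ i))))

*ₛ-zeroˡ : ∀ f → 0ₛ *ₛ f ≈ₛ 0ₛ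
*ₛ-zeroˡ f k = trans (·ₛ-*ₛ-assoc 0ℚ 0ₛ f k) (*-zeroˡ ((0ₛ *ₛ f) k))

*ₛ-zeroʳ : ∀ f → f *ₛ 0ₛ ≈ₛ 0ₛ
*ₛ-zeroʳ f k = trans (*ₛ-·ₛ-comm 0ℚ f 0ₛ k) (*-zeroˡ ((f *ₛ 0ₛ) k))

const-*ₛ : ∀ c f → const c *ₛ f ≈ₛ c ·ₛ f
const-*ₛ c f zero    = +-identityʳ (c * f 0)
const-*ₛ c f (suc k) = trans (cong (c * f (suc k) +_) (*ₛ-zeroˡ f k)) (+-identityʳ _)

shift-*ₛ : ∀ f g → shift f *ₛ g ≈ₛ shift (f *ₛ g)
shift-*ₛ f g zero    = trans (+-identityʳ _) (*-zeroˡ (g 0))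
shift-*ₛ f g (suc k) = trans (cong (_+ (f *ₛ g) k) (*-zeroˡ (g (suc k)))) (+-identityˡ _)

*ₛ-shift : ∀ f g → f *ₛ shift g ≈ₛ shift (f *ₛ g)
*ₛ-shift f g zero          = trans (+-identityʳ _) (*-zeroʳ (f 0))
*ₛ-shift f g (suc zero)    = cong (f 0 * g 0 +_) (*ₛ-shift (f ∘ suc) g 0)
*ₛ-shift f g (suc (suc k)) = cong (f 0 * g (suc k) +_) (*ₛ-shift (f ∘ suc) g (suc k))

*ₛ-shift^ : ∀ r f g → f *ₛ shift^ r g ≈ₛ shift^ r (f *ₛ g)
*ₛ-shift^ zero    f g k = refl
*ₛ-shift^ (suc r) f g k = trans (*ₛ-shift f (shift^ r g) k) (shift-cong (*ₛ-shift^ r f g) k)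

*ₛ-assoc : ∀ f g h → (f *ₛ g) *ₛ h ≈ₛ f *ₛ (g *ₛ h)
*ₛ-assoc f g h zero = solve 3 (λ f g h → (f :* g :+ con 0ℚ) :* h :+ con 0ℚ
  := f :* (g :* h :+ con 0ℚ) :+ con 0ℚ) refl (f 0) (g 0) (h 0)
*ₛ-assoc f g h (suc k) = begin
  -- `(f *ₛ g) ∘ suc` is by computation `f 0 ·ₛ (g ∘ suc) +ₛ (f ∘ suc) *ₛ g`; the induction
  -- hypothesis serves the second summand.
  (f 0 * g 0 + 0ℚ) * h (suc k) + ((f 0 ·ₛ (g ∘ suc) +ₛ (f ∘ suc) *ₛ g) *ₛ h) k
    ≡⟨ cong ((f 0 * g 0 + 0ℚ) * h (suc k) +_)
         (trans (*ₛ-distribʳ-+ₛ (f 0 ·ₛ (g ∘ suc)) ((f ∘ suc) *ₛ g) h k)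
                (cong₂ _+_ (·ₛ-*ₛ-assoc (f 0) (g ∘ suc) h k) (*ₛ-assoc (f ∘ suc) g h k))) ⟩
  (f 0 * g 0 + 0ℚ) * h (suc k) + (f 0 * ((g ∘ suc) *ₛ h) k + ((f ∘ suc) *ₛ (g *ₛ h)) k)
    ≡⟨ solve 5 (λ f g h x y → (f :* g :+ con 0ℚ) :* h :+ (f :* x :+ y) := f :* (g :* h :+ x) :+ y) refl
         (f 0) (g 0) (h (suc k)) _ _ ⟩
  f 0 * (g *ₛ h) (suc k) + ((f ∘ suc) *ₛ (g *ₛ h)) k ∎

Y-*ₛ : ∀ f → Y *ₛ f ≈ₛ shift f
Y-*ₛ f k = begin
  (Y *ₛ f) k                 ≡⟨ *ₛ-cong {g = f} Y≈shift-1 (λ _ → refl) k ⟩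
  (shift (const 1ℚ) *ₛ f) k  ≡⟨ shift-*ₛ (const 1ℚ) f k ⟩
  shift (const 1ℚ *ₛ f) k    ≡⟨ shift-cong (λ i → trans (const-*ₛ 1ℚ f i) (*-identityˡ (f i))) k ⟩
  shift f k                  ∎
  where
  Y≈shift-1 : Y ≈ₛ shift (const 1ℚ)
  Y≈shift-1 zero          = refl
  Y≈shift-1 (suc zero)    = refl
  Y≈shift-1 (suc (suc k)) = refl

∑<-*ₛ : ∀ m f (g : ℕ → PowerSeries) k →
  ∑< m (λ r → (f *ₛ g r) k) ≡ (f *ₛ (λ j → ∑< m (λ r → g r j))) k
∑<-*ₛ zero    f g k = sym (*ₛ-zeroʳ f k)
∑<-*ₛ (suc m) f g k =
  trans (cong ((f *ₛ g 0) k +_) (∑<-*ₛ m f (g ∘ suc) k))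
        (sym (*ₛ-distribˡ-+ₛ f (g 0) (λ j → ∑< m (λ r → g (suc r) j)) k))

-- Powers of 1+y

bin-zero≈1 : bin 0 ≈ₛ const 1ℚ
bin-zero≈1 zero    = refl
bin-zero≈1 (suc k) = refl

bin-suc : ∀ n → bin (suc n) ≈ₛ bin n +ₛ shift (bin n)
bin-suc n zero    = refl
bin-suc n (suc k) = trans (bin-pascal n k) (solve 2 (λ x y → x :+ y := y :+ x) refl (bin n k) _)

bin-zero-*ₛ : ∀ f → bin 0 *ₛ f ≈ₛ f
bin-zero-*ₛ f k = begin
  (bin 0 *ₛ f) k     ≡⟨ *ₛ-cong {g = f} bin-zero≈1 (λ _ → refl) k ⟩
  (const 1ℚ *ₛ f) k  ≡⟨ const-*ₛ 1ℚ f k ⟩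
  1ℚ * f k           ≡⟨ *-identityˡ (f k) ⟩
  f k                ∎

bin-suc-*ₛ : ∀ n f → bin (suc n) *ₛ f ≈ₛ bin n *ₛ f +ₛ shift (bin n *ₛ f)
bin-suc-*ₛ n f k = begin
  (bin (suc n) *ₛ f) k                       ≡⟨ *ₛ-cong {g = f} (bin-suc n) (λ _ → refl) k ⟩
  ((bin n +ₛ shift (bin n)) *ₛ f) k          ≡⟨ *ₛ-distribʳ-+ₛ (bin n) (shift (bin n)) f k ⟩
  (bin n *ₛ f) k + (shift (bin n) *ₛ f) k    ≡⟨ cong ((bin n *ₛ f) k +_) (shift-*ₛ (bin n) f k) ⟩
  (bin n *ₛ f) k + shift (bin n *ₛ f) k      ∎

-- Vandermonde's identity; Pascal's rule, as multiplication by 1+y, carries the induction on `m`.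
bin-*ₛ-bin : ∀ m n → bin m *ₛ bin n ≈ₛ bin (m ℕ.+ n)
bin-*ₛ-bin zero    n k = bin-zero-*ₛ (bin n) k
bin-*ₛ-bin (suc m) n k = begin
  (bin (suc m) *ₛ bin n) k                        ≡⟨ bin-suc-*ₛ m (bin n) k ⟩
  (bin m *ₛ bin n) k + shift (bin m *ₛ bin n) k   ≡⟨ cong₂ _+_ (bin-*ₛ-bin m n k) (shift-cong (bin-*ₛ-bin m n) k) ⟩
  bin (m ℕ.+ n) k + shift (bin (m ℕ.+ n)) k       ≡⟨ bin-suc (m ℕ.+ n) k ⟨
  bin (suc m ℕ.+ n) k                             ∎

[Y+1]^≈bin : ∀ n → (Y +ₛ const 1ℚ) ^ₛ n ≈ₛ bin n
[Y+1]^≈bin zero    k = sym (bin-zero≈1 k)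
[Y+1]^≈bin (suc n) k = begin
  ((Y +ₛ const 1ℚ) *ₛ (Y +ₛ const 1ℚ) ^ₛ n) k  ≡⟨ *ₛ-cong 1+Y≈bin-1 ([Y+1]^≈bin n) k ⟩
  (bin 1 *ₛ bin n) k                           ≡⟨ bin-*ₛ-bin 1 n k ⟩
  bin (suc n) k                                ∎
  where
  1+Y≈bin-1 : Y +ₛ const 1ℚ ≈ₛ bin 1
  1+Y≈bin-1 zero          = refl
  1+Y≈bin-1 (suc zero)    = refl
  1+Y≈bin-1 (suc (suc k)) = refl

-- Two absorptions lower n, k and r by one at once. This is trinomial revision C(n,k) C(k,r) =
-- C(n,r) C(n-r,k-r); writing the last factor as a coefficient of yʳ (1+y)ˢ covers k < r and turns
-- it into an identity of series in `k`.
trinomial : ∀ r s k → bin (r ℕ.+ s) k * bin k r ≡ bin (r ℕ.+ s) r * shift^ r (bin s) k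
trinomial zero    s k    = *-comm (bin s k) 1ℚ
trinomial (suc r) s zero = trans (*-zeroʳ (bin (suc r ℕ.+ s) 0)) (sym (*-zeroʳ (bin (suc r ℕ.+ s) (suc r))))
trinomial (suc r) s (suc k) = *-cancelˡ (1+fromℕ≢0 r) (begin
  (1ℚ + R) * (bin (suc n) (suc k) * bin (suc k) (suc r))  ≡⟨ xyz (1ℚ + R) (bin (suc n) (suc k)) _ ⟩
  bin (suc n) (suc k) * ((1ℚ + R) * bin (suc k) (suc r))  ≡⟨ cong (bin (suc n) (suc k) *_) (bin-absorb k r) ⟩
  bin (suc n) (suc k) * ((1ℚ + fromℕ k) * bin k r)        ≡⟨ yxz (bin (suc n) (suc k)) (1ℚ + fromℕ k) _ ⟩
  ((1ℚ + fromℕ k) * bin (suc n) (suc k)) * bin k r        ≡⟨ cong (_* bin k r) (bin-absorb n k) ⟩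
  ((1ℚ + fromℕ n) * bin n k) * bin k r                    ≡⟨ *-assoc (1ℚ + fromℕ n) _ _ ⟩
  (1ℚ + fromℕ n) * (bin n k * bin k r)                    ≡⟨ cong ((1ℚ + fromℕ n) *_) (trinomial r s k) ⟩
  (1ℚ + fromℕ n) * (bin n r * S)                          ≡⟨ *-assoc (1ℚ + fromℕ n) _ _ ⟨
  ((1ℚ + fromℕ n) * bin n r) * S                          ≡⟨ cong (_* S) (bin-absorb n r) ⟨
  ((1ℚ + R) * bin (suc n) (suc r)) * S                    ≡⟨ *-assoc (1ℚ + R) _ _ ⟩
  (1ℚ + R) * (bin (suc n) (suc r) * S)                    ∎)
  where
  n = r ℕ.+ s
  R = fromℕ r
  S = shift^ r (bin s) k
  xyz : ∀ x y z → x * (y * z) ≡ y * (x * z)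
  xyz = solve 3 (λ x y z → x :* (y :* z) := y :* (x :* z)) refl
  yxz : ∀ x y z → x * (y * z) ≡ (y * x) * z
  yxz = solve 3 (λ x y z → x :* (y :* z) := (y :* x) :* z) refl

trinomial′ : ∀ {r n} → r ≤ n → ∀ k → bin n k * bin k r ≡ bin n r * shift^ r (bin (n ∸ r)) k
trinomial′ {r} {n} r≤n k =
  subst (λ N → bin N k * bin k r ≡ bin N r * shift^ r (bin (n ∸ r)) k) (ℕ.m+[n∸m]≡n r≤n)
        (trinomial r (n ∸ r) k)

-- Differentiation

θ : PowerSeries → PowerSeries
θ f k = fromℕ k * f k

-- The map f ↦ (y f)′. Unlike `θ`, which is y d/dy, it multiplies no coefficient by 0, so it can be
-- undone by cancellation.
1+θ : PowerSeries → PowerSeries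
1+θ f k = (1ℚ + fromℕ k) * f k

-- The Leibniz rule for the product of f and y g.
1+θ-*ₛ : ∀ f g → 1+θ (f *ₛ g) ≈ₛ θ f *ₛ g +ₛ f *ₛ 1+θ g
1+θ-*ₛ f g zero = solve 2 (λ f g → (con 1ℚ :+ con 0ℚ) :* (f :* g :+ con 0ℚ)
  := (con 0ℚ :* f :* g :+ con 0ℚ) :+ (f :* ((con 1ℚ :+ con 0ℚ) :* g) :+ con 0ℚ)) refl (f 0) (g 0)
1+θ-*ₛ f g (suc k) = begin
  (1ℚ + K′) * (f₀ * g′ + X)
    ≡⟨ solve 4 (λ K f g x → (con 1ℚ :+ K) :* (f :* g :+ x)
         := f :* ((con 1ℚ :+ K) :* g) :+ x :+ K :* x) refl K′ f₀ g′ X ⟩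
  f₀ * ((1ℚ + K′) * g′) + X + K′ * X
    ≡⟨ cong (f₀ * ((1ℚ + K′) * g′) + X +_)
         (trans (cong (_* X) (fromℕ-suc k)) (1+θ-*ₛ (f ∘ suc) g k)) ⟩
  f₀ * ((1ℚ + K′) * g′) + X + ((θ (f ∘ suc) *ₛ g) k + Z)
    ≡⟨ solve 6 (λ K f g x y z → f :* ((con 1ℚ :+ K) :* g) :+ x :+ (y :+ z)
         := (con 0ℚ :* f :* g :+ (x :+ y)) :+ (f :* ((con 1ℚ :+ K) :* g) :+ z)) refl K′ f₀ g′ X _ Z ⟩
  (0ℚ * f₀ * g′ + (X + (θ (f ∘ suc) *ₛ g) k)) + (f₀ * ((1ℚ + K′) * g′) + Z)
    ≡⟨ cong (λ w → (0ℚ * f₀ * g′ + w) + (f₀ * ((1ℚ + K′) * g′) + Z)) θ-tail ⟨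
  (θ f *ₛ g +ₛ f *ₛ 1+θ g) (suc k) ∎
  where
  f₀ = f 0
  g′ = g (suc k)
  K′ = fromℕ (suc k)
  X = ((f ∘ suc) *ₛ g) k
  Z = ((f ∘ suc) *ₛ 1+θ g) k
  -- Dropping the constant term lowers every index by one, so the weight j + 1 in `θ f` splits into
  -- 1 and the weight j in `θ (f ∘ suc)`.
  θ-tail : ((θ f ∘ suc) *ₛ g) k ≡ X + (θ (f ∘ suc) *ₛ g) k
  θ-tail = begin
    ((θ f ∘ suc) *ₛ g) k
      ≡⟨ *ₛ-cong {f′ = (f ∘ suc) +ₛ θ (f ∘ suc)} {g = g} (λ j →
           trans (cong (_* f (suc j)) (fromℕ-suc j))
                 (solve 2 (λ j x → (con 1ℚ :+ j) :* x := x :+ j :* x) refl (fromℕ j) (f (suc j)))) (λ _ → refl) k ⟩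
    (((f ∘ suc) +ₛ θ (f ∘ suc)) *ₛ g) k
      ≡⟨ *ₛ-distribʳ-+ₛ (f ∘ suc) (θ (f ∘ suc)) g k ⟩
    X + (θ (f ∘ suc) *ₛ g) k ∎

θ-bin-suc : ∀ n → θ (bin (suc n)) ≈ₛ shift (fromℕ (suc n) ·ₛ bin n)
θ-bin-suc n zero    = refl
θ-bin-suc n (suc k) = begin
  fromℕ (suc k) * bin (suc n) (suc k)   ≡⟨ cong (_* bin (suc n) (suc k)) (fromℕ-suc k) ⟩
  (1ℚ + fromℕ k) * bin (suc n) (suc k)  ≡⟨ bin-absorb n k ⟩
  (1ℚ + fromℕ n) * bin n k              ≡⟨ cong (_* bin n k) (fromℕ-suc n) ⟨
  fromℕ (suc n) * bin n k               ∎

shift-+ₛ : ∀ f g → shift (f +ₛ g) ≈ₛ shift f +ₛ shift g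
shift-+ₛ f g zero    = refl
shift-+ₛ f g (suc k) = refl

-- Coefficientwise form of ((1+y)ⁿ⁺¹ y g)′ = (1+y)ⁿ ((1+y) (y g)′ + (n+1) y g).
1+θ-bin-suc-*ₛ : ∀ n g →
  1+θ (bin (suc n) *ₛ g) ≈ₛ bin n *ₛ (1+θ g +ₛ shift (1+θ g +ₛ fromℕ (suc n) ·ₛ g))
1+θ-bin-suc-*ₛ n g k = begin
  1+θ (bin (suc n) *ₛ g) k
    ≡⟨ 1+θ-*ₛ (bin (suc n)) g k ⟩
  (θ (bin (suc n)) *ₛ g) k + (bin (suc n) *ₛ 1+θ g) k
    ≡⟨ cong₂ _+_ θ-part (bin-suc-*ₛ n (1+θ g) k) ⟩
  shift (bin n *ₛ (c ·ₛ g)) k + ((bin n *ₛ 1+θ g) k + shift (bin n *ₛ 1+θ g) k)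
    ≡⟨ solve 3 (λ x y z → x :+ (y :+ z) := y :+ (z :+ x)) refl
         (shift (bin n *ₛ (c ·ₛ g)) k) ((bin n *ₛ 1+θ g) k) (shift (bin n *ₛ 1+θ g) k) ⟩
  (bin n *ₛ 1+θ g) k + (shift (bin n *ₛ 1+θ g) k + shift (bin n *ₛ (c ·ₛ g)) k)
    ≡⟨ cong ((bin n *ₛ 1+θ g) k +_) shift-part ⟨
  (bin n *ₛ 1+θ g) k + (bin n *ₛ shift (1+θ g +ₛ c ·ₛ g)) k
    ≡⟨ *ₛ-distribˡ-+ₛ (bin n) (1+θ g) (shift (1+θ g +ₛ c ·ₛ g)) k ⟨
  (bin n *ₛ (1+θ g +ₛ shift (1+θ g +ₛ c ·ₛ g))) k ∎
  where
  c = fromℕ (suc n)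
  θ-part : (θ (bin (suc n)) *ₛ g) k ≡ shift (bin n *ₛ (c ·ₛ g)) k
  θ-part = begin
    (θ (bin (suc n)) *ₛ g) k       ≡⟨ *ₛ-cong {g = g} (θ-bin-suc n) (λ _ → refl) k ⟩
    (shift (c ·ₛ bin n) *ₛ g) k    ≡⟨ shift-*ₛ (c ·ₛ bin n) g k ⟩
    shift ((c ·ₛ bin n) *ₛ g) k    ≡⟨ shift-cong (λ j → trans (·ₛ-*ₛ-assoc c (bin n) g j)
                                        (sym (*ₛ-·ₛ-comm c (bin n) g j))) k ⟩
    shift (bin n *ₛ (c ·ₛ g)) k    ∎
  shift-part : (bin n *ₛ shift (1+θ g +ₛ c ·ₛ g)) k
             ≡ shift (bin n *ₛ 1+θ g) k + shift (bin n *ₛ (c ·ₛ g)) k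
  shift-part = begin
    (bin n *ₛ shift (1+θ g +ₛ c ·ₛ g)) k
      ≡⟨ *ₛ-shift (bin n) (1+θ g +ₛ c ·ₛ g) k ⟩
    shift (bin n *ₛ (1+θ g +ₛ c ·ₛ g)) k
      ≡⟨ shift-cong (*ₛ-distribˡ-+ₛ (bin n) (1+θ g) (c ·ₛ g)) k ⟩
    shift (bin n *ₛ 1+θ g +ₛ bin n *ₛ (c ·ₛ g)) k
      ≡⟨ shift-+ₛ (bin n *ₛ 1+θ g) (bin n *ₛ (c ·ₛ g)) k ⟩
    shift (bin n *ₛ 1+θ g) k + shift (bin n *ₛ (c ·ₛ g)) k ∎

-- The first-order relation between g and H

-- The series ₂F₁[p+1, -q; 1; -y].
H : ℕ → ℕ → PowerSeries
H p q j = bin (p ℕ.+ j) j * bin q j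

-- The sign of -y turns -q + j into q - j. Absorption gives the ratio for C(p+j,j), whose upper
-- index moves with j, and `bin-step` the one for C(q,j).
H-step : ∀ p q j →
  H p q (suc j) * ((1ℚ + fromℕ j) * (1ℚ + fromℕ j))
    ≡ H p q j * ((1ℚ + (fromℕ p + fromℕ j)) * (fromℕ q - fromℕ j))
H-step p q j = begin
  (bin (p ℕ.+ suc j) (suc j) * bin q (suc j)) * ((1ℚ + J) * (1ℚ + J))
    ≡⟨ cong (λ n → (bin n (suc j) * bin q (suc j)) * ((1ℚ + J) * (1ℚ + J))) (ℕ.+-suc p j) ⟩
  (bin (suc (p ℕ.+ j)) (suc j) * bin q (suc j)) * ((1ℚ + J) * (1ℚ + J))
    ≡⟨ solve 3 (λ x y J → (x :* y) :* (J :* J) := (J :* x) :* (J :* y)) refl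
         (bin (suc (p ℕ.+ j)) (suc j)) (bin q (suc j)) (1ℚ + J) ⟩
  ((1ℚ + J) * bin (suc (p ℕ.+ j)) (suc j)) * ((1ℚ + J) * bin q (suc j))
    ≡⟨ cong₂ _*_ (bin-absorb (p ℕ.+ j) j) (bin-step q j) ⟩
  ((1ℚ + fromℕ (p ℕ.+ j)) * bin (p ℕ.+ j) j) * ((fromℕ q - J) * bin q j)
    ≡⟨ cong (λ z → ((1ℚ + z) * bin (p ℕ.+ j) j) * ((fromℕ q - J) * bin q j)) (fromℕ-+ p j) ⟩
  ((1ℚ + (fromℕ p + J)) * bin (p ℕ.+ j) j) * ((fromℕ q - J) * bin q j)
    ≡⟨ solve 4 (λ a b c d → (a :* b) :* (c :* d) := (b :* d) :* (a :* c)) refl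
         (1ℚ + (fromℕ p + J)) (bin (p ℕ.+ j) j) (fromℕ q - J) (bin q j) ⟩
  H p q j * ((1ℚ + (fromℕ p + J)) * (fromℕ q - J)) ∎
  where J = fromℕ j

G : ℕ → ℕ → PowerSeries
G p n = ₂F₁ (fromℕ p + 1ℚ) (fromℕ p - fromℕ n + 1ℚ) (fromℕ 2) [ - 1ℚ ·y]

module _ {p q n} (p+q≡n : p ℕ.+ q ≡ n) where

  private
    P = fromℕ p
    Q = fromℕ q

    fromℕ-n : fromℕ n ≡ P + Q
    fromℕ-n = trans (cong fromℕ (sym p+q≡n)) (fromℕ-+ p q)

  -- For n = p + q the second upper parameter is 1 - q, and the sign of -y turns 1 - q + j into q -
  -- (1 + j).
  G-step : ∀ j →
    G p n (suc j) * ((1ℚ + (1ℚ + fromℕ j)) * (1ℚ + fromℕ j))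
      ≡ G p n j * ((1ℚ + (P + fromℕ j)) * (Q - (1ℚ + fromℕ j)))
  G-step j = begin
    (t′ * (- 1ℚ * s)) * ((1ℚ + (1ℚ + J)) * (1ℚ + J))
      ≡⟨ solve 3 (λ t s J → (t :* (con (- 1ℚ) :* s)) :* ((con 1ℚ :+ (con 1ℚ :+ J)) :* (con 1ℚ :+ J))
           := (con (- 1ℚ) :* s) :* (t :* ((con (fromℕ 2) :+ J) :* (con 1ℚ :+ J)))) refl t′ s J ⟩
    (- 1ℚ * s) * (t′ * ((fromℕ 2 + J) * (1ℚ + J)))
      ≡⟨ cong (- 1ℚ * s *_) (₂F₁-step (P + 1ℚ) (P - fromℕ n + 1ℚ) (fromℕ 2) j
           (λ eq → fromℕ-suc≢0 (suc j) (trans (fromℕ-+ 2 j) eq))) ⟩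
    (- 1ℚ * s) * (t * ((P + 1ℚ + J) * (P - fromℕ n + 1ℚ + J)))
      ≡⟨ cong (λ z → (- 1ℚ * s) * (t * ((P + 1ℚ + J) * (P - z + 1ℚ + J)))) fromℕ-n ⟩
    (- 1ℚ * s) * (t * ((P + 1ℚ + J) * (P - (P + Q) + 1ℚ + J)))
      ≡⟨ solve 5 (λ P Q t s J →
           (con (- 1ℚ) :* s) :* (t :* ((P :+ con 1ℚ :+ J) :* (P :- (P :+ Q) :+ con 1ℚ :+ J)))
           := (t :* s) :* ((con 1ℚ :+ (P :+ J)) :* (Q :- (con 1ℚ :+ J)))) refl P Q t s J ⟩
    (t * s) * ((1ℚ + (P + J)) * (Q - (1ℚ + J))) ∎
    where
    J = fromℕ j
    s = _^_ +-*-rawSemiring (- 1ℚ) j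
    t = ₂F₁ (P + 1ℚ) (P - fromℕ n + 1ℚ) (fromℕ 2) j
    t′ = ₂F₁ (P + 1ℚ) (P - fromℕ n + 1ℚ) (fromℕ 2) (suc j)

  -- Coefficientwise H′ = q (p + 1 + θ) g: differentiating ₂F₁[p+1, -q; 1; -y] raises every
  -- parameter by one, and (p+1) (p+2)_j = (p+1)_j (p+1+j). The induction compares the term ratios
  -- of the two sides. The factor q stays undivided because it may be 0.
  G-H : ∀ j → (1ℚ + (P + fromℕ j)) * Q * G p n j ≡ (1ℚ + fromℕ j) * H p q (suc j)
  G-H zero = begin
    (1ℚ + (P + 0ℚ)) * Q * 1ℚ
      ≡⟨ solve 2 (λ P Q → (con 1ℚ :+ (P :+ con 0ℚ)) :* Q :* con 1ℚ
           := con 1ℚ :* ((con 1ℚ :+ (P :+ con 0ℚ)) :* (Q :- con 0ℚ))) refl P Q ⟩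
    1ℚ * ((1ℚ + (P + 0ℚ)) * (Q - 0ℚ))
      ≡⟨ H-step p q 0 ⟨
    H p q 1 * ((1ℚ + 0ℚ) * (1ℚ + 0ℚ))
      ≡⟨ solve 1 (λ h → h :* ((con 1ℚ :+ con 0ℚ) :* (con 1ℚ :+ con 0ℚ))
           := (con 1ℚ :+ con 0ℚ) :* h) refl (H p q 1) ⟩
    (1ℚ + 0ℚ) * H p q 1 ∎
  G-H (suc j) = *-cancelˡ (*-≢0 2+j≢0 (1+fromℕ≢0 j)) (begin
    (1ℚ + (1ℚ + J)) * (1ℚ + J) * ((1ℚ + (P + fromℕ (suc j))) * Q * G′)
      ≡⟨ cong (λ z → (1ℚ + (1ℚ + J)) * (1ℚ + J) * ((1ℚ + (P + z)) * Q * G′)) (fromℕ-suc j) ⟩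
    (1ℚ + (1ℚ + J)) * (1ℚ + J) * ((1ℚ + (P + (1ℚ + J))) * Q * G′)
      ≡⟨ solve 4 (λ J a Q g → (con 1ℚ :+ (con 1ℚ :+ J)) :* (con 1ℚ :+ J) :* (a :* Q :* g)
           := a :* Q :* (g :* ((con 1ℚ :+ (con 1ℚ :+ J)) :* (con 1ℚ :+ J)))) refl J a Q G′ ⟩
    a * Q * (G′ * ((1ℚ + (1ℚ + J)) * (1ℚ + J)))
      ≡⟨ cong (a * Q *_) (G-step j) ⟩
    a * Q * (G p n j * ((1ℚ + (P + J)) * (Q - (1ℚ + J))))
      ≡⟨ solve 5 (λ a b c Q g → a :* Q :* (g :* (b :* c)) := a :* c :* (b :* Q :* g)) refl
           a (1ℚ + (P + J)) (Q - (1ℚ + J)) Q (G p n j) ⟩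
    a * (Q - (1ℚ + J)) * ((1ℚ + (P + J)) * Q * G p n j)
      ≡⟨ cong (a * (Q - (1ℚ + J)) *_) (G-H j) ⟩
    a * (Q - (1ℚ + J)) * ((1ℚ + J) * H p q (suc j))
      ≡⟨ solve 4 (λ a b c h → a :* b :* (c :* h) := c :* (h :* (a :* b))) refl
           a (Q - (1ℚ + J)) (1ℚ + J) (H p q (suc j)) ⟩
    (1ℚ + J) * (H p q (suc j) * (a * (Q - (1ℚ + J))))
      ≡⟨ cong ((1ℚ + J) *_)
           (subst (λ z → H″ * ((1ℚ + z) * (1ℚ + z)) ≡ H p q (suc j) * ((1ℚ + (P + z)) * (Q - z)))
                  (fromℕ-suc j) (H-step p q (suc j))) ⟨
    (1ℚ + J) * (H″ * ((1ℚ + (1ℚ + J)) * (1ℚ + (1ℚ + J))))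
      ≡⟨ solve 3 (λ x y h → x :* (h :* (y :* y)) := y :* x :* (y :* h)) refl (1ℚ + J) (1ℚ + (1ℚ + J)) H″ ⟩
    (1ℚ + (1ℚ + J)) * (1ℚ + J) * ((1ℚ + (1ℚ + J)) * H″)
      ≡⟨ cong (λ z → (1ℚ + (1ℚ + J)) * (1ℚ + J) * ((1ℚ + z) * H″)) (fromℕ-suc j) ⟨
    (1ℚ + (1ℚ + J)) * (1ℚ + J) * ((1ℚ + fromℕ (suc j)) * H″) ∎)
    where
    J = fromℕ j
    a = 1ℚ + (P + (1ℚ + J))
    G′ = G p n (suc j)
    H″ = H p q (suc (suc j))
    2+j≢0 : 1ℚ + (1ℚ + J) ≢ 0ℚ
    2+j≢0 eq = 1+fromℕ≢0 (suc j) (trans (cong (1ℚ +_) (fromℕ-suc j)) eq)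

  1+θ-G : 1+θ (G p n) +ₛ shift (1+θ (G p n) +ₛ P ·ₛ G p n) ≈ₛ H p q
  1+θ-G zero    = refl
  1+θ-G (suc j) = *-cancelˡ (1+fromℕ≢0 j) (begin
    (1ℚ + J) * ((1ℚ + fromℕ (suc j)) * G′ + ((1ℚ + J) * g + P * g))
      ≡⟨ cong (λ z → (1ℚ + J) * ((1ℚ + z) * G′ + ((1ℚ + J) * g + P * g))) (fromℕ-suc j) ⟩
    (1ℚ + J) * ((1ℚ + (1ℚ + J)) * G′ + ((1ℚ + J) * g + P * g))
      ≡⟨ solve 4 (λ P J g h → (con 1ℚ :+ J) :* ((con 1ℚ :+ (con 1ℚ :+ J)) :* h :+ ((con 1ℚ :+ J) :* g :+ P :* g))
           := h :* ((con 1ℚ :+ (con 1ℚ :+ J)) :* (con 1ℚ :+ J)) :+ g :* ((con 1ℚ :+ (P :+ J)) :* (con 1ℚ :+ J))) refl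
           P J g G′ ⟩
    G′ * ((1ℚ + (1ℚ + J)) * (1ℚ + J)) + g * ((1ℚ + (P + J)) * (1ℚ + J))
      ≡⟨ cong (_+ g * ((1ℚ + (P + J)) * (1ℚ + J))) (G-step j) ⟩
    g * ((1ℚ + (P + J)) * (Q - (1ℚ + J))) + g * ((1ℚ + (P + J)) * (1ℚ + J))
      -- The two summands differ only in the factors q - (1 + j) and 1 + j, which add up to the q of
      -- `G-H`.
      ≡⟨ solve 4 (λ a Q J g → g :* (a :* (Q :- J)) :+ g :* (a :* J) := a :* Q :* g) refl
           (1ℚ + (P + J)) Q (1ℚ + J) g ⟩
    (1ℚ + (P + J)) * Q * g
      ≡⟨ G-H j ⟩
    (1ℚ + J) * H p q (suc j) ∎)
    where
    J = fromℕ j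
    g = G p n j
    G′ = G p n (suc j)

-- Pfaff transformation: from H to D

-- Vandermonde and the reflection C(j,j-r) = C(j,r) expand C(p+j,j) over r ≤ j; the factor C(q,j)
-- then allows the cut at r = min(p,q).
H≡∑ : ∀ p q j → H p q j ≡ ∑< (suc (p ⊓ q)) (λ r → bin q j * (bin p r * bin j r))
H≡∑ p q j = begin
  bin (p ℕ.+ j) j * bin q j                       ≡⟨ *-comm (bin (p ℕ.+ j) j) (bin q j) ⟩
  bin q j * bin (p ℕ.+ j) j                       ≡⟨ cong (bin q j *_) (bin-*ₛ-bin p j j) ⟨
  bin q j * ∑< (suc j) (λ r → bin p r * bin j (j ∸ r))
    ≡⟨ cong (bin q j *_) (∑<-cong (suc j) (λ r r<1+j →
         cong (λ z → bin p r * fromℕ z) (nCk≡nC[n∸k] (ℕ.≤-pred r<1+j)))) ⟨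
  bin q j * ∑< (suc j) (λ r → bin p r * bin j r)  ≡⟨ *-distribˡ-∑< (suc j) (bin q j) (λ r → bin p r * bin j r) ⟩
  ∑< (suc j) t                                    ≡⟨ ∑<-truncate (suc j) (suc (p ⊓ q)) {t} r>j r>p⊓q ⟩
  ∑< (suc (p ⊓ q)) t                              ∎
  where
  t : ℕ → ℚ
  t r = bin q j * (bin p r * bin j r)
  r>j : ∀ r → j < r → t r ≡ 0ℚ
  r>j r j<r = begin
    bin q j * (bin p r * bin j r)  ≡⟨ cong (λ z → bin q j * (bin p r * z)) (k>n⇒bin≡0 j<r) ⟩
    bin q j * (bin p r * 0ℚ)       ≡⟨ cong (bin q j *_) (*-zeroʳ (bin p r)) ⟩
    bin q j * 0ℚ                   ≡⟨ *-zeroʳ (bin q j) ⟩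
    0ℚ                             ∎
  r>p : ∀ r → p < r → t r ≡ 0ℚ
  r>p r p<r = begin
    bin q j * (bin p r * bin j r)  ≡⟨ cong (λ z → bin q j * (z * bin j r)) (k>n⇒bin≡0 p<r) ⟩
    bin q j * (0ℚ * bin j r)       ≡⟨ cong (bin q j *_) (*-zeroˡ (bin j r)) ⟩
    bin q j * 0ℚ                   ≡⟨ *-zeroʳ (bin q j) ⟩
    0ℚ                             ∎
  -- `bin q r` is not a factor of the term: for r > q either j < r and C(j,r) = 0, or q < r ≤ j and
  -- C(q,j) = 0.
  r>q : ∀ r → q < r → t r ≡ 0ℚ
  r>q r q<r with ℕ.<-≤-connex j r
  ... | inj₁ j<r = r>j r j<r
  ... | inj₂ r≤j = trans (cong (_* (bin p r * bin j r)) (k>n⇒bin≡0 (ℕ.<-≤-trans q<r r≤j)))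
                         (*-zeroˡ (bin p r * bin j r))
  r>p⊓q : ∀ r → p ⊓ q < r → t r ≡ 0ℚ
  r>p⊓q r p⊓q<r with ℕ.⊓-sel p q
  ... | inj₁ p⊓q≡p = r>p r (subst (_< r) p⊓q≡p p⊓q<r)
  ... | inj₂ p⊓q≡q = r>q r (subst (_< r) p⊓q≡q p⊓q<r)

-- The series ∑ᵣ C(p,r) C(q,r) yʳ (1+y)ᴺ⁻ʳ, on which the two sides meet when N = p+q-1.
D : ℕ → ℕ → ℕ → PowerSeries
D p q N m = ∑< (suc (p ⊓ q)) (λ r → (bin p r * bin q r) * shift^ r (bin (N ∸ r)) m)

-- Because r ≤ q, the power (1+y)^(p+q-r) contains (1+y)^p for every r. By trinomial revision the
-- rest of the r-th term, C(p+1,r) C(q,r) yʳ (1+y)^(q-r), has the coefficients C(p+1,r) C(q,j)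
-- C(j,r) summed in `H≡∑`.
D-suc : ∀ p q → D (suc p) q (p ℕ.+ q) ≈ₛ bin p *ₛ H (suc p) q
D-suc p q m = begin
  D (suc p) q (p ℕ.+ q) m
    ≡⟨ ∑<-cong R (λ r r<R → term r (ℕ.≤-trans (ℕ.≤-pred r<R) (ℕ.m⊓n≤n (suc p) q))) ⟩
  ∑< R (λ r → (bin p *ₛ t r) m)
    ≡⟨ ∑<-*ₛ R (bin p) t m ⟩
  (bin p *ₛ (λ j → ∑< R (λ r → t r j))) m
    ≡⟨ *ₛ-cong {f = bin p} (λ _ → refl) (λ j → sym (H≡∑ (suc p) q j)) m ⟩
  (bin p *ₛ H (suc p) q) m ∎
  where
  R = suc (suc p ⊓ q)
  t : ℕ → PowerSeries
  t r j = bin q j * (bin (suc p) r * bin j r)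
  term : ∀ r → r ≤ q →
    (bin (suc p) r * bin q r) * shift^ r (bin (p ℕ.+ q ∸ r)) m ≡ (bin p *ₛ t r) m
  term r r≤q = begin
    c * shift^ r (bin (p ℕ.+ q ∸ r)) m
      ≡⟨ cong (λ n → c * shift^ r (bin n) m) (ℕ.+-∸-assoc p r≤q) ⟩
    c * shift^ r (bin (p ℕ.+ (q ∸ r))) m
      ≡⟨ cong (c *_) (shift^-cong r (bin-*ₛ-bin p (q ∸ r)) m) ⟨
    c * shift^ r (bin p *ₛ bin (q ∸ r)) m
      ≡⟨ cong (c *_) (*ₛ-shift^ r (bin p) (bin (q ∸ r)) m) ⟨
    c * (bin p *ₛ shift^ r (bin (q ∸ r))) m
      ≡⟨ *ₛ-·ₛ-comm c (bin p) (shift^ r (bin (q ∸ r))) m ⟨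
    (bin p *ₛ (c ·ₛ shift^ r (bin (q ∸ r)))) m
      ≡⟨ *ₛ-cong {f = bin p} (λ _ → refl) coefficient m ⟩
    (bin p *ₛ t r) m ∎
    where
    c = bin (suc p) r * bin q r
    coefficient : c ·ₛ shift^ r (bin (q ∸ r)) ≈ₛ t r
    coefficient j = begin
      (bin (suc p) r * bin q r) * shift^ r (bin (q ∸ r)) j  ≡⟨ *-assoc (bin (suc p) r) (bin q r) _ ⟩
      bin (suc p) r * (bin q r * shift^ r (bin (q ∸ r)) j)  ≡⟨ cong (bin (suc p) r *_) (trinomial′ r≤q j) ⟨
      bin (suc p) r * (bin q j * bin j r)                   ≡⟨ solve 3 (λ x y z → x :* (y :* z) := y :* (x :* z)) refl
                                                                 (bin (suc p) r) (bin q j) (bin j r) ⟩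
      t r j                                                 ∎

1+θ-bin-*ₛ-G : ∀ {p q N} → p ℕ.+ q ≡ suc N → 1+θ (bin p *ₛ G p (suc N)) ≈ₛ D p q N
1+θ-bin-*ₛ-G {zero} {q} {N} refl m = begin
  (1ℚ + M) * (bin 0 *ₛ G 0 (suc N)) m    ≡⟨ cong ((1ℚ + M) *_) (bin-zero-*ₛ (G 0 (suc N)) m) ⟩
  (1ℚ + M) * G 0 (suc N) m               ≡⟨ *-cancelˡ (1+fromℕ≢0 N) cleared ⟩
  -- min(0,q) = 0 leaves the single term r = 0 of `D`.
  bin N m                                ≡⟨ solve 1 (λ x → x := con 1ℚ :* x :+ con 0ℚ) refl (bin N m) ⟩
  1ℚ * bin N m + 0ℚ                      ∎
  where
  M = fromℕ m
  -- For p = 0 the coefficients of H are C(q,j), and `G-H` determines g directly: its factor q is N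
  -- + 1, hence nonzero.
  cleared : (1ℚ + fromℕ N) * ((1ℚ + M) * G 0 (suc N) m) ≡ (1ℚ + fromℕ N) * bin N m
  cleared = begin
    (1ℚ + fromℕ N) * ((1ℚ + M) * G 0 (suc N) m)
      ≡⟨ solve 3 (λ N M g → N :* ((con 1ℚ :+ M) :* g) := (con 1ℚ :+ (con 0ℚ :+ M)) :* N :* g) refl
           (1ℚ + fromℕ N) M (G 0 (suc N) m) ⟩
    (1ℚ + (0ℚ + M)) * (1ℚ + fromℕ N) * G 0 (suc N) m
      ≡⟨ cong (λ z → (1ℚ + (0ℚ + M)) * z * G 0 (suc N) m) (fromℕ-suc N) ⟨
    (1ℚ + (0ℚ + M)) * fromℕ (suc N) * G 0 (suc N) m
      ≡⟨ G-H {0} {suc N} refl m ⟩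
    (1ℚ + M) * (bin (suc m) (suc m) * bin (suc N) (suc m))
      ≡⟨ cong (λ z → (1ℚ + M) * (fromℕ z * bin (suc N) (suc m))) (nCn≡1 (suc m)) ⟩
    (1ℚ + M) * (1ℚ * bin (suc N) (suc m))
      ≡⟨ cong ((1ℚ + M) *_) (*-identityˡ (bin (suc N) (suc m))) ⟩
    (1ℚ + M) * bin (suc N) (suc m)
      ≡⟨ bin-absorb N m ⟩
    (1ℚ + fromℕ N) * bin N m ∎
1+θ-bin-*ₛ-G {suc p} {q} refl m = begin
  1+θ (bin (suc p) *ₛ g) m
    ≡⟨ 1+θ-bin-suc-*ₛ p g m ⟩
  (bin p *ₛ (1+θ g +ₛ shift (1+θ g +ₛ fromℕ (suc p) ·ₛ g))) m
    ≡⟨ *ₛ-cong {f = bin p} (λ _ → refl) (1+θ-G {suc p} {q} refl) m ⟩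
  (bin p *ₛ H (suc p) q) m
    ≡⟨ D-suc p q m ⟨
  D (suc p) q (p ℕ.+ q) m ∎
  where g = G (suc p) (suc p ℕ.+ q)

-- The ₃F₂ side

-- Keeps r ≤ min(p,q) within r ≤ N = n - 1, where neither (1-n)_r nor C(N,r) vanishes.
m+n≡1+o⇒m⊓n≤o : ∀ m {n o} → m ℕ.+ n ≡ suc o → m ⊓ n ≤ o
m+n≡1+o⇒m⊓n≤o zero    _    = z≤n
m+n≡1+o⇒m⊓n≤o (suc m) {n} refl = ℕ.≤-trans (ℕ.m⊓n≤n (suc m) n) (ℕ.m≤n+m n m)

module _ {p q N} (p+q≡1+N : p ℕ.+ q ≡ suc N) (m : ℕ) where

  private
    M = fromℕ m
    P = fromℕ p
    Q = fromℕ q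

    T : ℕ → ℚ
    T = ₃F₂-coeff (1ℚ - fromℕ (suc m)) (- P) (P - fromℕ (suc N)) (1ℚ - fromℕ (suc N)) 1ℚ

  -- With k = m + 1 and n = N + 1 = p + q the parameters are -m, -p, -q over -N and 1. Passing from
  -- -x + r to x - r costs three signs above and one below, so none remains.
  T-step : ∀ {r} → r < N → let R = fromℕ r in
    T (suc r) * ((fromℕ N - R) * (1ℚ + R) * (1ℚ + R)) ≡ T r * ((M - R) * (P - R) * (Q - R))
  T-step {r} r<N = begin
    T (suc r) * ((fromℕ N - R) * (1ℚ + R) * (1ℚ + R))
      ≡⟨ solve 3 (λ t N R → t :* ((N :- R) :* (con 1ℚ :+ R) :* (con 1ℚ :+ R))
           := con (- 1ℚ) :* (t :* ((con 1ℚ :- (con 1ℚ :+ N) :+ R) :* (con 1ℚ :+ R) :* (con 1ℚ :+ R)))) refl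
           (T (suc r)) (fromℕ N) R ⟩
    - 1ℚ * (T (suc r) * ((1ℚ - (1ℚ + fromℕ N) + R) * (1ℚ + R) * (1ℚ + R)))
      ≡⟨ cong (λ z → - 1ℚ * (T (suc r) * ((1ℚ - z + R) * (1ℚ + R) * (1ℚ + R)))) (fromℕ-suc N) ⟨
    - 1ℚ * (T (suc r) * ((1ℚ - fromℕ (suc N) + R) * (1ℚ + R) * (1ℚ + R)))
      ≡⟨ cong (- 1ℚ *_) (₃F₂-step (1ℚ - fromℕ (suc m)) (- P) (P - fromℕ (suc N))
           (1ℚ - fromℕ (suc N)) 1ℚ r d≢0 (1+fromℕ≢0 r)) ⟩
    - 1ℚ * (T r * ((1ℚ - fromℕ (suc m) + R) * (- P + R) * (P - fromℕ (suc N) + R)))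
      ≡⟨ cong₂ (λ x y → - 1ℚ * (T r * ((1ℚ - x + R) * (- P + R) * (P - y + R))))
           (fromℕ-suc m) (trans (cong fromℕ (sym p+q≡1+N)) (fromℕ-+ p q)) ⟩
    - 1ℚ * (T r * ((1ℚ - (1ℚ + M) + R) * (- P + R) * (P - (P + Q) + R)))
      ≡⟨ solve 5 (λ t M P Q R →
           con (- 1ℚ) :* (t :* ((con 1ℚ :- (con 1ℚ :+ M) :+ R) :* (:- P :+ R) :* (P :- (P :+ Q) :+ R)))
           := t :* ((M :- R) :* (P :- R) :* (Q :- R))) refl (T r) M P Q R ⟩
    T r * ((M - R) * (P - R) * (Q - R)) ∎
    where
    R = fromℕ r
    d≢0 : 1ℚ - fromℕ (suc N) + R ≢ 0ℚ
    d≢0 eq = fromℕ-∸≢0 r<N (begin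
      fromℕ N - R                      ≡⟨ solve 2 (λ N R → N :- R := :- (con 1ℚ :- (con 1ℚ :+ N) :+ R)) refl (fromℕ N) R ⟩
      - (1ℚ - (1ℚ + fromℕ N) + R)      ≡⟨ cong (λ z → - (1ℚ - z + R)) (fromℕ-suc N) ⟨
      - (1ℚ - fromℕ (suc N) + R)       ≡⟨ cong -_ eq ⟩
      0ℚ                               ∎)

  -- Each (-x)_r is (-1)ʳ r! C(x,r), so signs and factorials cancel and C(N,r) is the only
  -- denominator left. The induction runs on the term ratio, whose factor N - r is nonzero for r <
  -- N.
  T-closed : ∀ r → r ≤ N → T r * bin N r ≡ bin m r * bin p r * bin q r
  T-closed zero    _   = refl
  T-closed (suc r) r<N = *-cancelˡ
    (*-≢0 (fromℕ-∸≢0 r<N) (*-≢0 (1+fromℕ≢0 r) (*-≢0 (1+fromℕ≢0 r) (1+fromℕ≢0 r)))) (begin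
    N-R * (1+R * (1+R * 1+R)) * (T (suc r) * bin N (suc r))
      ≡⟨ solve 4 (λ n r t b → n :* (r :* (r :* r)) :* (t :* b) := (t :* (n :* r :* r)) :* (r :* b)) refl
           N-R 1+R (T (suc r)) (bin N (suc r)) ⟩
    T (suc r) * (N-R * 1+R * 1+R) * (1+R * bin N (suc r))
      ≡⟨ cong₂ _*_ (T-step r<N) (bin-step N r) ⟩
    T r * ((M - R) * (P - R) * (Q - R)) * (N-R * bin N r)
      ≡⟨ solve 6 (λ t x y z n b → t :* (x :* y :* z) :* (n :* b) := n :* (x :* y :* z) :* (t :* b)) refl
           (T r) (M - R) (P - R) (Q - R) N-R (bin N r) ⟩
    N-R * ((M - R) * (P - R) * (Q - R)) * (T r * bin N r)
      ≡⟨ cong (N-R * ((M - R) * (P - R) * (Q - R)) *_) (T-closed r (ℕ.<⇒≤ r<N)) ⟩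
    N-R * ((M - R) * (P - R) * (Q - R)) * (bin m r * bin p r * bin q r)
      ≡⟨ solve 7 (λ n x y z a b c → n :* (x :* y :* z) :* (a :* b :* c)
           := n :* ((x :* a) :* (y :* b) :* (z :* c))) refl
           N-R (M - R) (P - R) (Q - R) (bin m r) (bin p r) (bin q r) ⟩
    N-R * (((M - R) * bin m r) * ((P - R) * bin p r) * ((Q - R) * bin q r))
      ≡⟨ cong (N-R *_) (cong₂ _*_ (cong₂ _*_ (bin-step m r) (bin-step p r)) (bin-step q r)) ⟨
    N-R * ((1+R * bin m (suc r)) * (1+R * bin p (suc r)) * (1+R * bin q (suc r)))
      ≡⟨ solve 5 (λ n r a b c → n :* ((r :* a) :* (r :* b) :* (r :* c))
           := n :* (r :* (r :* r)) :* (a :* b :* c)) refl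
           N-R 1+R (bin m (suc r)) (bin p (suc r)) (bin q (suc r)) ⟩
    N-R * (1+R * (1+R * 1+R)) * (bin m (suc r) * bin p (suc r) * bin q (suc r)) ∎)
    where
    R = fromℕ r
    1+R = 1ℚ + R
    N-R = fromℕ N - R

  -- Here the denominator of `T r` disappears: trinomial revision trades C(N,m) C(m,r) for C(N,r)
  -- times a coefficient of yʳ (1+y)^(N-r).
  bin-*-T : ∀ r → r ≤ N →
    bin N m * T r ≡ (bin p r * bin q r) * shift^ r (bin (N ∸ r)) m
  bin-*-T r r≤N = *-cancelˡ (bin≢0 r r≤N) (begin
    bin N r * (bin N m * T r)
      ≡⟨ solve 3 (λ x y z → x :* (y :* z) := y :* (z :* x)) refl (bin N r) (bin N m) (T r) ⟩
    bin N m * (T r * bin N r)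
      ≡⟨ cong (bin N m *_) (T-closed r r≤N) ⟩
    bin N m * (bin m r * bin p r * bin q r)
      ≡⟨ solve 4 (λ n x y z → n :* (x :* y :* z) := (n :* x) :* (y :* z)) refl
           (bin N m) (bin m r) (bin p r) (bin q r) ⟩
    (bin N m * bin m r) * (bin p r * bin q r)
      ≡⟨ cong (_* (bin p r * bin q r)) (trinomial′ r≤N m) ⟩
    (bin N r * S) * (bin p r * bin q r)
      ≡⟨ solve 3 (λ n s x → (n :* s) :* x := n :* (x :* s)) refl (bin N r) S (bin p r * bin q r) ⟩
    bin N r * ((bin p r * bin q r) * S) ∎)
    where S = shift^ r (bin (N ∸ r)) m

  ₃F₂≡D : (1ℚ + M) * (bin (suc N) (suc m) * ∑< (suc (p ⊓ q)) T) ≡ fromℕ (suc N) * D p q N m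
  ₃F₂≡D = begin
    (1ℚ + M) * (bin (suc N) (suc m) * ∑< B T)  ≡⟨ *-assoc (1ℚ + M) (bin (suc N) (suc m)) (∑< B T) ⟨
    (1ℚ + M) * bin (suc N) (suc m) * ∑< B T    ≡⟨ cong (_* ∑< B T) (bin-absorb N m) ⟩
    (1ℚ + fromℕ N) * bin N m * ∑< B T          ≡⟨ cong (λ z → z * bin N m * ∑< B T) (fromℕ-suc N) ⟨
    fromℕ (suc N) * bin N m * ∑< B T           ≡⟨ *-assoc (fromℕ (suc N)) (bin N m) (∑< B T) ⟩
    fromℕ (suc N) * (bin N m * ∑< B T)         ≡⟨ cong (fromℕ (suc N) *_) (*-distribˡ-∑< B (bin N m) T) ⟩
    fromℕ (suc N) * ∑< B (λ r → bin N m * T r) ≡⟨ cong (fromℕ (suc N) *_) (∑<-cong B (λ r r<B →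
                                                    bin-*-T r (ℕ.≤-trans (ℕ.≤-pred r<B) (m+n≡1+o⇒m⊓n≤o p p+q≡1+N)))) ⟩
    fromℕ (suc N) * D p q N m                  ∎
    where B = suc (p ⊓ q)

-- Comparison of the two sides

const-*ₛ-Y-*ₛ : ∀ c f g → const c *ₛ Y *ₛ f *ₛ g ≈ₛ c ·ₛ shift (f *ₛ g)
const-*ₛ-Y-*ₛ c f g k = begin
  (const c *ₛ Y *ₛ f *ₛ g) k        ≡⟨ *ₛ-assoc (const c *ₛ Y) f g k ⟩
  (const c *ₛ Y *ₛ (f *ₛ g)) k      ≡⟨ *ₛ-assoc (const c) Y (f *ₛ g) k ⟩
  (const c *ₛ (Y *ₛ (f *ₛ g))) k    ≡⟨ const-*ₛ c (Y *ₛ (f *ₛ g)) k ⟩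
  c * (Y *ₛ (f *ₛ g)) k             ≡⟨ cong (c *_) (Y-*ₛ (f *ₛ g) k) ⟩
  c * shift (f *ₛ g) k              ∎

theorem3 : (n p : ℕ) → 1 ≤ n → p ≤ n →
    ∑≥1 (binom n p)
    ≈ₛ const (fromℕ n) *ₛ Y *ₛ (Y +ₛ const 1ℚ) ^ₛ p
    *ₛ (₂F₁ (fromℕ p + 1ℚ) (fromℕ p - fromℕ n + 1ℚ) (fromℕ 2) [ - 1ℚ ·y])
theorem3 n@(suc N) p _ p≤n zero = sym (begin
  _                         ≡⟨ const-*ₛ-Y-*ₛ (fromℕ n) ((Y +ₛ const 1ℚ) ^ₛ p) (G p n) 0 ⟩
  fromℕ n * 0ℚ              ≡⟨ *-zeroʳ (fromℕ n) ⟩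
  0ℚ                        ∎)
theorem3 n@(suc N) p _ p≤n (suc m) = begin
  binom n p (suc m)                            ≡⟨ *-cancelˡ (1+fromℕ≢0 m) cleared ⟩
  fromℕ n * (bin p *ₛ G p n) m                 ≡⟨ cong (fromℕ n *_) (*ₛ-cong {g = G p n} ([Y+1]^≈bin p) (λ _ → refl) m) ⟨
  fromℕ n * ((Y +ₛ const 1ℚ) ^ₛ p *ₛ G p n) m  ≡⟨ const-*ₛ-Y-*ₛ (fromℕ n) ((Y +ₛ const 1ℚ) ^ₛ p) (G p n) (suc m) ⟨
  _                                            ∎
  where
  p+q≡n : p ℕ.+ (n ∸ p) ≡ n
  p+q≡n = ℕ.m+[n∸m]≡n p≤n
  -- The factor k = m + 1 enables absorption on the left and is the action of `1+θ` on the right.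
  cleared : (1ℚ + fromℕ m) * binom n p (suc m) ≡ (1ℚ + fromℕ m) * (fromℕ n * (bin p *ₛ G p n) m)
  cleared = begin
    (1ℚ + fromℕ m) * binom n p (suc m)                   ≡⟨ ₃F₂≡D {p} {n ∸ p} {N} p+q≡n m ⟩
    fromℕ n * D p (n ∸ p) N m                            ≡⟨ cong (fromℕ n *_) (1+θ-bin-*ₛ-G {p} {n ∸ p} {N} p+q≡n m) ⟨
    fromℕ n * ((1ℚ + fromℕ m) * (bin p *ₛ G p n) m)      ≡⟨ solve 3 (λ x y z → x :* (y :* z) := y :* (x :* z)) refl
                                                              (fromℕ n) (1ℚ + fromℕ m) ((bin p *ₛ G p n) m) ⟩
    (1ℚ + fromℕ m) * (fromℕ n * (bin p *ₛ G p n) m)      ∎
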